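{- Let $\Gamma$ be a typing environment, $\sigma$ a channel state and $P$ a process. If the configuration $\sigma\triangleright P$ is well-typed, $\Gamma\vdash\sigma\triangleright P$, then $\sigma\triangleright P$ has no error reduction, i.e., $\sigma\triangleright P\not\to^{\mathrm{err}}$.
   Context: Syntax (π-calculus with allocation). Channel names $c,d\in\mathcal N$, variables $x,y$, identifiers $u,v$ ranging over both, process variables $X$. Processes: $P,Q ::= u!\langle\vec v\rangle.P \mid u?(\vec x).P \mid \mathbf 0 \mid \mathsf{if}\ u=v\ \mathsf{then}\ P\ \mathsf{else}\ Q \mid \mathsf{rec}\,X.P \mid X \mid P\mid Q \mid (\nu c{:}s)P \mid \mathsf{alloc}\,x.P \mid \mathsf{free}\,u.P$, where $s\in\{\top,\bot\}$ (allocated/deallocated). Input binds $\vec x$, $\mathsf{alloc}$ binds $x$, $(\nu c{:}s)$ binds $c$, $\mathsf{rec}$ binds $X$. A channel state is a finite partial map $\sigma$ from channel names to $\{\top,\bot\}$; a configuration $\sigma\triangleright P$ requires the free names of $P$ to lie in $\mathrm{dom}(\sigma)$; it is closed if $P$ has no free variables. Contexts: $\mathcal C ::= [-]\mid \mathcal C\mid P\mid P\mid\mathcal C\mid (\nu c)\mathcal C$, applied to configurations by $[\sigma\triangleright P]=\sigma\triangleright P$; if $\mathcal C[\sigma\triangleright P]=\sigma'\triangleright P'$ then $(\mathcal C\mid Q)[\sigma\triangleright P]=\sigma'\triangleright(P'\mid Q)$, $(Q\mid\mathcal C)[\sigma\triangleright P]=\sigma'\triangleright(Q\mid P')$; and if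 $\mathcal C[\sigma\triangleright P]=\sigma',c{:}s\triangleright P'$ then $((\nu c)\mathcal C)[\sigma\triangleright P]=\sigma'\triangleright(\nu c{:}s)P'$. $\equiv$ is a standard π-calculus structural equivalence. Error reduction $\to^{\mathrm{err}}$ is the least relation on configurations closed under contexts (if $\sigma\triangleright P\to^{\mathrm{err}}$ then $\mathcal C[\sigma\triangleright P]\to^{\mathrm{err}}$) satisfying: $\sigma\triangleright c!\langle\vec d\rangle.P\mid c?(\vec x).Q\to^{\mathrm{err}}$ if $|\vec d|\ne|\vec x|$; $\sigma\triangleright c!\langle\vec d\rangle.P\to^{\mathrm{err}}$ if $\sigma(c)=\bot$; $\sigma\triangleright c?(\vec x).Q\to^{\mathrm{err}}$ if $\sigma(c)=\bot$; and $\sigma\triangleright P\to^{\mathrm{err}}$ if $P\equiv Q$ and $\sigma\triangleright Q\to^{\mathrm{err}}$. Types: $T::=[T_1,\dots,T_n]^a\mid\mathsf{Proc}$, attributes $a::=\mathsf{aff}\mid\mathsf{un}\mid\bullet_i$ ($i\in\mathbb N$; $\bullet_i$ = unique after $i$ steps). Typing environments are finite multisets of assumptions $u:T$ or $X:\mathsf{Proc}$. Decrement: $\Gamma,u:[\vec T]^{a-1}$ is $\Gamma$ if $a=\mathsf{aff}$, $\Gamma,u:[\vec T]^{\mathsf{un}}$ if $a=\mathsf{un}$, $\Gamma,u:[\vec T]^{\bullet_i}$ if $a=\bullet_{i+1}$. Splitting: $[\vec T]^{\mathsf{un}}=[\vec T]^{\mathsf{un}}\circ[\vec T]^{\mathsf{un}}$,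 $\mathsf{Proc}=\mathsf{Proc}\circ\mathsf{Proc}$, $[\vec T]^{\bullet_i}=[\vec T]^{\mathsf{aff}}\circ[\vec T]^{\bullet_{i+1}}$. Subtyping rules: $\bullet_i\le\bullet_{i+1}$, $\bullet_{i+1}\le\mathsf{un}$, $\mathsf{un}\le\mathsf{aff}$, $[\vec T]^{a_1}\le[\vec T]^{a_2}$ if $a_1\le a_2$. The judgement $\Gamma\vdash P$ is inductively defined by (bound variables fresh, commas denote multiset union): if $\Gamma,u:[\vec T]^{a-1},\vec x:\vec T\vdash P$ then $\Gamma,u:[\vec T]^a\vdash u?(\vec x).P$; if $\Gamma,u:[\vec T]^{a-1}\vdash P$ then $\Gamma,u:[\vec T]^a,\vec v:\vec T\vdash u!\langle\vec v\rangle.P$; if $\Gamma_1\vdash P$ and $\Gamma_2\vdash Q$ then $\Gamma_1,\Gamma_2\vdash P\mid Q$; if $u,v$ occur in $\Gamma$, $\Gamma\vdash P$ and $\Gamma\vdash Q$ then $\Gamma\vdash\mathsf{if}\ u=v\ \mathsf{then}\ P\ \mathsf{else}\ Q$; if $\Gamma^{\mathsf{un}},X:\mathsf{Proc}\vdash P$ then $\Gamma^{\mathsf{un}}\vdash\mathsf{rec}\,X.P$, where $\Gamma^{\mathsf{un}}$ contains only unrestricted assumptions; $X:\mathsf{Proc}\vdash X$; if $\Gamma,x:[\vec T]^{\bullet_0}\vdash P$ then $\Gamma\vdash\mathsf{alloc}\,x.P$; if $\Gamma\vdash P$ then $\Gamma,u:[\vec T]^{\bullet_0}\vdash\mathsf{free}\,u.P$;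 $\emptyset\vdash\mathbf 0$; if $\Gamma,c:T\vdash P$ then $\Gamma\vdash(\nu c{:}\top)P$; if $\Gamma\vdash P$ then $\Gamma\vdash(\nu c{:}\bot)P$; and the structural rules: if $T=T_1\circ T_2$ and $\Gamma,u:T_1,u:T_2\vdash P$ then $\Gamma,u:T\vdash P$; if $\Gamma\vdash P$ then $\Gamma,u:T\vdash P$; if $\Gamma,u:T_2\vdash P$ and $T_1\le T_2$ then $\Gamma,u:T_1\vdash P$; if $\Gamma,u:[\vec T_2]^{\bullet_0}\vdash P$ then $\Gamma,u:[\vec T_1]^{\bullet_0}\vdash P$. Configuration typing: $\Gamma\vdash\sigma\triangleright P$ holds iff $\sigma(c)=\top$ for every channel name $c\in\mathrm{dom}(\Gamma)$, $\Gamma\vdash P$, and $\Gamma$ is a partial function. -}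

module Defs where

open import Data.Fin using (Fin; zero; suc; lift; _↑ˡ_; _↑ʳ_)
open import Data.List using (List; []; _∷_; _++_; map)
open import Data.List.Membership.Propositional using (_∈_)
open import Data.List.Relation.Binary.Permutation.Propositional using (_↭_)
open import Data.List.Relation.Unary.All using (All)
open import Data.List.Relation.Unary.Unique.Propositional using (Unique)
open import Data.Nat using (ℕ; suc; _+_)
open import Data.Product using (∃-syntax)
open import Data.Vec as Vec using (Vec; []; _∷_; lookup; allFin; zipWith; toList)
open import Function using (id)
open import Relation.Binary.PropositionalEquality using (_≡_; _≢_)

-- Terms are taken up to α-conversion, as well-scoped de Bruijn terms:
-- n, m, k always count the channel names, variables and process variables
-- in scope.

data Status : Set where
  allocated deallocated : Status

data Ident (n m : ℕ) : Set where
  name : Fin n → Ident n m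
  var  : Fin m → Ident n m

infixr 8 _∥_
infix  9 if_≟_then_else_

-- In  inp u a P  the a bound variables x₀ … x₍ₐ₋₁₎ are the first a variables
-- of P; they are distinct by construction.
data Proc (n m k : ℕ) : Set where
  out   : ∀ {a} → Ident n m → Vec (Ident n m) a → Proc n m k → Proc n m k
  inp   : Ident n m → (a : ℕ) → Proc n (a + m) k → Proc n m k
  nil   : Proc n m k
  if_≟_then_else_ : Ident n m → Ident n m → Proc n m k → Proc n m k → Proc n m k
  rec   : Proc n m (suc k) → Proc n m k
  pvar  : Fin k → Proc n m k
  _∥_   : Proc n m k → Proc n m k → Proc n m k
  ν     : Status → Proc (suc n) m k → Proc n m k
  alloc : Proc n (suc m) k → Proc n m k
  free  : Ident n m → Proc n m k → Proc n m k

renameIdent : ∀ {n n′ m m′} → (Fin n → Fin n′) → (Fin m → Fin m′) →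
              Ident n m → Ident n′ m′
renameIdent ρ τ (name c) = name (ρ c)
renameIdent ρ τ (var x)  = var (τ x)

renameNames : ∀ {n n′ m k} → (Fin n → Fin n′) → Proc n m k → Proc n′ m k
renameNames ρ (out u vs P) =
  out (renameIdent ρ id u) (Vec.map (renameIdent ρ id) vs) (renameNames ρ P)
renameNames ρ (inp u a P)  = inp (renameIdent ρ id u) a (renameNames ρ P)
renameNames ρ nil          = nil
renameNames ρ (if u ≟ v then P else Q) =
  if renameIdent ρ id u ≟ renameIdent ρ id v then renameNames ρ P else renameNames ρ Q
renameNames ρ (rec P)      = rec (renameNames ρ P)
renameNames ρ (pvar X)     = pvar X
renameNames ρ (P ∥ Q)      = renameNames ρ P ∥ renameNames ρ Q
renameNames ρ (ν s P)      = ν s (renameNames (lift 1 ρ) P)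
renameNames ρ (alloc P)    = alloc (renameNames ρ P)
renameNames ρ (free u P)   = free (renameIdent ρ id u) (renameNames ρ P)

swap₀₁ : ∀ {n} → Fin (suc (suc n)) → Fin (suc (suc n))
swap₀₁ zero          = suc zero
swap₀₁ (suc zero)    = zero
swap₀₁ (suc (suc i)) = suc (suc i)

infix 4 _≅_

-- Structural equivalence: the least congruence (for all process constructors)
-- containing the usual laws. Unfolding of recursion is not one of them.
data _≅_ : ∀ {n m k} → Proc n m k → Proc n m k → Set where
  ≅-refl  : ∀ {n m k} {P : Proc n m k} → P ≅ P
  ≅-sym   : ∀ {n m k} {P Q : Proc n m k} → P ≅ Q → Q ≅ P
  ≅-trans : ∀ {n m k} {P Q R : Proc n m k} → P ≅ Q → Q ≅ R → P ≅ R

  ∥-comm  : ∀ {n m k} {P Q : Proc n m k} → P ∥ Q ≅ Q ∥ P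
  ∥-assoc : ∀ {n m k} {P Q R : Proc n m k} → P ∥ (Q ∥ R) ≅ (P ∥ Q) ∥ R
  ∥-nil   : ∀ {n m k} {P : Proc n m k} → P ∥ nil ≅ P
  ν-nil   : ∀ {n m k s} → ν {n} {m} {k} s nil ≅ nil
  ν-swap  : ∀ {n m k s s′} {P : Proc (suc (suc n)) m k} →
            ν s (ν s′ P) ≅ ν s′ (ν s (renameNames swap₀₁ P))
  -- The side condition c ∉ fn(P) is that P, under the binder, is a shifted process.
  ν-ext   : ∀ {n m k s} {P : Proc n m k} {Q : Proc (suc n) m k} →
            P ∥ ν s Q ≅ ν s (renameNames suc P ∥ Q)

  out-cong   : ∀ {n m k a u} {vs : Vec (Ident n m) a} {P P′ : Proc n m k} →
               P ≅ P′ → out u vs P ≅ out u vs P′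
  inp-cong   : ∀ {n m k u a} {P P′ : Proc n (a + m) k} →
               P ≅ P′ → inp {n} {m} u a P ≅ inp u a P′
  if-cong    : ∀ {n m k u v} {P P′ Q Q′ : Proc n m k} → P ≅ P′ → Q ≅ Q′ →
               if u ≟ v then P else Q ≅ if u ≟ v then P′ else Q′
  rec-cong   : ∀ {n m k} {P P′ : Proc n m (suc k)} → P ≅ P′ → rec P ≅ rec P′
  ∥-cong     : ∀ {n m k} {P P′ Q Q′ : Proc n m k} → P ≅ P′ → Q ≅ Q′ → P ∥ Q ≅ P′ ∥ Q′
  ν-cong     : ∀ {n m k s} {P P′ : Proc (suc n) m k} → P ≅ P′ → ν s P ≅ ν s P′
  alloc-cong : ∀ {n m k} {P P′ : Proc n (suc m) k} → P ≅ P′ → alloc P ≅ alloc P′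
  free-cong  : ∀ {n m k u} {P P′ : Proc n m k} → P ≅ P′ → free u P ≅ free u P′

-- A channel state with domain {c₀ , … , cₙ₋₁}.
State : ℕ → Set
State n = Vec Status n

infix 5 _▷_

-- The names in scope are exactly dom(σ), so fn(P) ⊆ dom(σ) holds by scoping.
record Config (n m k : ℕ) : Set where
  constructor _▷_
  field
    state   : State n
    process : Proc n m k

-- Ctx n′ m k n: contexts over n names whose hole lies in the scope of n′ names.
data Ctx (n′ m k : ℕ) : ℕ → Set where
  hole : Ctx n′ m k n′
  _∥ˡ_ : ∀ {n} → Ctx n′ m k n → Proc n m k → Ctx n′ m k n
  _∥ʳ_ : ∀ {n} → Proc n m k → Ctx n′ m k n → Ctx n′ m k n
  νᶜ   : ∀ {n} → Ctx n′ m k (suc n) → Ctx n′ m k n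

_⟨_⟩ : ∀ {n′ m k n} → Ctx n′ m k n → Config n′ m k → Config n m k
hole ⟨ κ ⟩ = κ
(C ∥ˡ Q) ⟨ κ ⟩ with C ⟨ κ ⟩
... | σ ▷ P = σ ▷ (P ∥ Q)
(Q ∥ʳ C) ⟨ κ ⟩ with C ⟨ κ ⟩
... | σ ▷ P = σ ▷ (Q ∥ P)
(νᶜ C) ⟨ κ ⟩ with C ⟨ κ ⟩
... | (s ∷ σ) ▷ P = σ ▷ ν s P

infix 4 _→err

data _→err : ∀ {n m k} → Config n m k → Set where
  err-arity : ∀ {n m k a b} {σ : State n} {c} {ds : Vec (Fin n) a}
              {P : Proc n m k} {Q : Proc n (b + m) k} → a ≢ b →
              σ ▷ (out (name c) (Vec.map name ds) P ∥ inp (name c) b Q) →err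
  err-out   : ∀ {n m k a} {σ : State n} {c} {ds : Vec (Fin n) a} {P : Proc n m k} →
              lookup σ c ≡ deallocated →
              σ ▷ out (name c) (Vec.map name ds) P →err
  err-inp   : ∀ {n m k b} {σ : State n} {c} {Q : Proc n (b + m) k} →
              lookup σ c ≡ deallocated →
              σ ▷ inp {n} {m} (name c) b Q →err
  err-≅     : ∀ {n m k} {σ : State n} {P Q : Proc n m k} →
              P ≅ Q → σ ▷ Q →err → σ ▷ P →err
  err-ctx   : ∀ {n′ m k n} (C : Ctx n′ m k n) {κ : Config n′ m k} →
              κ →err → C ⟨ κ ⟩ →err

infix 10 •_

data Attr : Set where
  aff un : Attr
  •_     : ℕ → Attr

data Type : Set where
  [_]^_ : ∀ {a} → Vec Type a → Attr → Type
  proc  : Type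

infix 6 _∶_

data Assumption (n m k : ℕ) : Set where
  _∶_    : Ident n m → Type → Assumption n m k
  _∶Proc : Fin k → Assumption n m k

-- Lists represent multisets: typing has an exchange rule.
Env : ℕ → ℕ → ℕ → Set
Env n m k = List (Assumption n m k)

renameAssumption : ∀ {n n′ m m′ k k′} → (Fin n → Fin n′) → (Fin m → Fin m′) →
                   (Fin k → Fin k′) → Assumption n m k → Assumption n′ m′ k′
renameAssumption ρ τ θ (u ∶ T)   = renameIdent ρ τ u ∶ T
renameAssumption ρ τ θ (X ∶Proc) = θ X ∶Proc

renameEnv : ∀ {n n′ m m′ k k′} → (Fin n → Fin n′) → (Fin m → Fin m′) →
            (Fin k → Fin k′) → Env n m k → Env n′ m′ k′
renameEnv ρ τ θ = map (renameAssumption ρ τ θ)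

data Subject (n m k : ℕ) : Set where
  ident   : Ident n m → Subject n m k
  procVar : Fin k → Subject n m k

subject : ∀ {n m k} → Assumption n m k → Subject n m k
subject (u ∶ T)   = ident u
subject (X ∶Proc) = procVar X

_∶⋆_ : ∀ {n m k a} → Vec (Ident n m) a → Vec Type a → Env n m k
vs ∶⋆ Ts = toList (zipWith _∶_ vs Ts)

-- Decrement u Ts a Δ: the (empty or singleton) environment "u : [Ts]^(a-1)" is Δ;
-- it is undefined for a = • 0.
data Decrement {n m k b} (u : Ident n m) (Ts : Vec Type b) : Attr → Env n m k → Set where
  dec-aff : Decrement u Ts aff []
  dec-un  : Decrement u Ts un (u ∶ [ Ts ]^ un ∷ [])
  dec-•   : ∀ {i} → Decrement u Ts (• suc i) (u ∶ [ Ts ]^ (• i) ∷ [])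

infix 4 _≔_∘_

data _≔_∘_ : Type → Type → Type → Set where
  split-un   : ∀ {a} {Ts : Vec Type a} → [ Ts ]^ un ≔ [ Ts ]^ un ∘ [ Ts ]^ un
  split-proc : proc ≔ proc ∘ proc
  split-•    : ∀ {a i} {Ts : Vec Type a} →
               [ Ts ]^ (• i) ≔ [ Ts ]^ aff ∘ [ Ts ]^ (• suc i)

infix 4 _≤ₐ_ _≤ₜ_

-- Only the generating rules: typing may apply subsumption repeatedly.
data _≤ₐ_ : Attr → Attr → Set where
  •≤•    : ∀ {i} → • i ≤ₐ • suc i
  •≤un   : ∀ {i} → • suc i ≤ₐ un
  un≤aff : un ≤ₐ aff

data _≤ₜ_ : Type → Type → Set where
  chan-≤ : ∀ {b a₁ a₂} {Ts : Vec Type b} → a₁ ≤ₐ a₂ → [ Ts ]^ a₁ ≤ₜ [ Ts ]^ a₂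

-- Assumptions of type Proc duplicate freely and count as unrestricted.
data Unrestricted {n m k} : Assumption n m k → Set where
  un-chan    : ∀ {u a} {Ts : Vec Type a} → Unrestricted (u ∶ [ Ts ]^ un)
  un-proc    : ∀ {u} → Unrestricted (u ∶ proc)
  un-procVar : ∀ {X} → Unrestricted (X ∶Proc)

_occursIn_ : ∀ {n m k} → Ident n m → Env n m k → Set
u occursIn Γ = ∃[ T ] (u ∶ T) ∈ Γ

infix 4 _⊢_ _⊢ᶜ_

-- Shifting Γ under a binder makes the bound identifiers fresh for it.
data _⊢_ : ∀ {n m k} → Env n m k → Proc n m k → Set where
  tIn   : ∀ {n m k b} {Γ Δ : Env n m k} {u a} {Ts : Vec Type b} {P : Proc n (b + m) k} →
          Decrement u Ts a Δ →
          (Vec.map (λ i → var (i ↑ˡ m)) (allFin b) ∶⋆ Ts) ++ renameEnv id (b ↑ʳ_) id (Δ ++ Γ) ⊢ P →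
          u ∶ [ Ts ]^ a ∷ Γ ⊢ inp u b P
  tOut  : ∀ {n m k b} {Γ Δ : Env n m k} {u a} {vs : Vec (Ident n m) b} {Ts : Vec Type b}
          {P : Proc n m k} →
          Decrement u Ts a Δ →
          Δ ++ Γ ⊢ P →
          u ∶ [ Ts ]^ a ∷ (vs ∶⋆ Ts) ++ Γ ⊢ out u vs P
  tPar  : ∀ {n m k} {Γ₁ Γ₂ : Env n m k} {P Q : Proc n m k} →
          Γ₁ ⊢ P → Γ₂ ⊢ Q → Γ₁ ++ Γ₂ ⊢ P ∥ Q
  tIf   : ∀ {n m k} {Γ : Env n m k} {u v} {P Q : Proc n m k} →
          u occursIn Γ → v occursIn Γ → Γ ⊢ P → Γ ⊢ Q → Γ ⊢ if u ≟ v then P else Q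
  tRec  : ∀ {n m k} {Γ : Env n m k} {P : Proc n m (suc k)} →
          All Unrestricted Γ →
          (zero ∶Proc) ∷ renameEnv id id suc Γ ⊢ P →
          Γ ⊢ rec P
  tVar  : ∀ {n m k} {X : Fin k} → (X ∶Proc) ∷ [] ⊢ pvar {n} {m} X
  tAll  : ∀ {n m k b} {Γ : Env n m k} {Ts : Vec Type b} {P : Proc n (suc m) k} →
          var zero ∶ [ Ts ]^ (• 0) ∷ renameEnv id suc id Γ ⊢ P →
          Γ ⊢ alloc P
  tFree : ∀ {n m k b} {Γ : Env n m k} {u} {Ts : Vec Type b} {P : Proc n m k} →
          Γ ⊢ P → u ∶ [ Ts ]^ (• 0) ∷ Γ ⊢ free u P
  tNil  : ∀ {n m k} → [] ⊢ nil {n} {m} {k}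
  tRst⊤ : ∀ {n m k} {Γ : Env n m k} {T} {P : Proc (suc n) m k} →
          name zero ∶ T ∷ renameEnv suc id id Γ ⊢ P →
          Γ ⊢ ν allocated P
  tRst⊥ : ∀ {n m k} {Γ : Env n m k} {P : Proc (suc n) m k} →
          renameEnv suc id id Γ ⊢ P →
          Γ ⊢ ν deallocated P

  tExch  : ∀ {n m k} {Γ Γ′ : Env n m k} {P : Proc n m k} → Γ ↭ Γ′ → Γ ⊢ P → Γ′ ⊢ P
  tCon   : ∀ {n m k} {Γ : Env n m k} {u T T₁ T₂} {P : Proc n m k} →
           T ≔ T₁ ∘ T₂ → u ∶ T₁ ∷ u ∶ T₂ ∷ Γ ⊢ P → u ∶ T ∷ Γ ⊢ P
  tConX  : ∀ {n m k} {Γ : Env n m k} {X} {P : Proc n m k} →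
           proc ≔ proc ∘ proc → (X ∶Proc) ∷ (X ∶Proc) ∷ Γ ⊢ P → (X ∶Proc) ∷ Γ ⊢ P
  tWeak  : ∀ {n m k} {Γ : Env n m k} {u T} {P : Proc n m k} → Γ ⊢ P → u ∶ T ∷ Γ ⊢ P
  tWeakX : ∀ {n m k} {Γ : Env n m k} {X} {P : Proc n m k} → Γ ⊢ P → (X ∶Proc) ∷ Γ ⊢ P
  tSub   : ∀ {n m k} {Γ : Env n m k} {u T₁ T₂} {P : Proc n m k} →
           u ∶ T₂ ∷ Γ ⊢ P → T₁ ≤ₜ T₂ → u ∶ T₁ ∷ Γ ⊢ P
  tRev   : ∀ {n m k a₁ a₂} {Γ : Env n m k} {u} {Ts₁ : Vec Type a₁} {Ts₂ : Vec Type a₂}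
           {P : Proc n m k} →
           u ∶ [ Ts₂ ]^ (• 0) ∷ Γ ⊢ P → u ∶ [ Ts₁ ]^ (• 0) ∷ Γ ⊢ P

record _⊢ᶜ_ {n m k} (Γ : Env n m k) (κ : Config n m k) : Set where
  open Config κ
  field
    live       : ∀ c → name c occursIn Γ → lookup state c ≡ allocated
    well-typed : Γ ⊢ process
    -- Γ is a partial function: no subject has two assumptions, even equal ones.
    functional : Unique (map subject Γ)

{-# OPTIONS --safe #-}
-- Structural equivalence is dealt with on the untyped side. Call a prefix active if it
-- lies under parallel compositions and restrictions only. An error requires, in the scope
-- of some restrictions, two active prefixes on one channel with different arities or an
-- active prefix on a deallocated channel, and this syntactic condition is invariant
-- under ≅, so no subject congruence theorem is needed.
-- On the typed side, only assumptions u : [T⃗]^•₀ may change their arity, and splitting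
-- never yields an assumption •₀. Starting from a partial function, the structural rules
-- thus maintain that distinct assumptions on one channel agree on the arity and that none
-- of them is •₀, so that parallel processes use the channel at the same arity.
module Submission where

open import Data.Empty using (⊥-elim)
open import Data.Fin using (Fin; zero; suc; lift)
open import Data.Fin.Properties using (suc-injective)
open import Data.List using ([]; _∷_; _++_; map)
open import Data.List.Membership.Propositional using (_∈_)
open import Data.List.Membership.Propositional.Properties using (∈-++⁺ˡ; ∈-++⁺ʳ; ∈-map⁻)
open import Data.List.Relation.Binary.Permutation.Propositional using (_↭_; ↭-sym; ↭⇒↭ₛ)
open import Data.List.Relation.Binary.Permutation.Propositional.Properties using (All-resp-↭; ∈-resp-↭)
import Data.List.Relation.Binary.Permutation.Setoid.Properties as SetoidPermutation
open import Data.List.Relation.Unary.All as All using (All; []; _∷_)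
import Data.List.Relation.Unary.All.Properties as Allₚ
open import Data.List.Relation.Unary.AllPairs as AllPairs using (AllPairs; []; _∷_)
import Data.List.Relation.Unary.AllPairs.Properties as AllPairsₚ
open import Data.List.Relation.Unary.Any using (here; there)
open import Data.Nat using (ℕ; suc)
open import Data.Product using (∃-syntax; _×_; _,_; proj₁; proj₂)
open import Data.Unit using (⊤; tt)
open import Data.Vec using (Vec; _∷_; lookup)
open import Function using (id; _∘_)
open import Function.Definitions using (Injective)
open import Relation.Binary.PropositionalEquality using (_≡_; _≢_; refl; sym; trans; cong; setoid; resp₂)
open import Relation.Nullary using (¬_)
open import Defs

private
  variable
    n n′ m k a b : ℕ

-- Active prefixes and errors

-- `under` asks for `suc c`, so only names free in the whole process are recorded. A prefix on a
-- restricted name becomes visible below its binder, through `Wrong`.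
data Active (a : ℕ) : Fin n → Proc n m k → Set where
  output : ∀ {c : Fin n} {vs : Vec (Ident n m) a} {P : Proc n m k} →
           Active a c (out (name c) vs P)
  input  : ∀ {c : Fin n} {P} → Active a c (inp {n} {m} {k} (name c) a P)
  left   : ∀ {c : Fin n} {P Q : Proc n m k} → Active a c P → Active a c (P ∥ Q)
  right  : ∀ {c : Fin n} {P Q : Proc n m k} → Active a c Q → Active a c (P ∥ Q)
  under  : ∀ {c : Fin n} {s} {P : Proc (suc n) m k} → Active a (suc c) P → Active a c (ν s P)

-- `clash` ignores polarity and is thus more liberal than `err-arity`; typing rules out every such
-- pair.
data Wrong {m k} : ∀ {n} → State n → Proc n m k → Set where
  clash : ∀ {σ : State n} {c P} → Active a c P → Active b c P → a ≢ b → Wrong σ P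
  dead  : ∀ {σ : State n} {c P} → Active a c P → lookup σ c ≡ deallocated → Wrong σ P
  left  : ∀ {σ : State n} {P Q} → Wrong σ P → Wrong σ (P ∥ Q)
  right : ∀ {σ : State n} {P Q} → Wrong σ Q → Wrong σ (P ∥ Q)
  under : ∀ {σ : State n} {s P} → Wrong (s ∷ σ) P → Wrong σ (ν s P)

-- An error of `ν s P` may also be a `clash` or a `dead` prefix on an outer name. Below the binder
-- it is one on the shifted name, whose status is the same by computation of `lookup`.
wrong-under⁻ : ∀ {σ : State n} {s} {P : Proc (suc n) m k} → Wrong σ (ν s P) → Wrong (s ∷ σ) P
wrong-under⁻ (clash (under x) (under y) a≢b) = clash x y a≢b
wrong-under⁻ (dead (under x) c-dead)         = dead x c-dead
wrong-under⁻ (under w)                       = w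

-- Renaming

lift-injective : (ρ : Fin n → Fin n′) → Injective _≡_ _≡_ ρ → Injective _≡_ _≡_ (lift 1 ρ)
lift-injective ρ inj {zero}  {zero}  eq = refl
lift-injective ρ inj {suc i} {suc j} eq = cong suc (inj (suc-injective eq))

swap₀₁-involutive : (i : Fin (suc (suc n))) → swap₀₁ (swap₀₁ i) ≡ i
swap₀₁-involutive zero          = refl
swap₀₁-involutive (suc zero)    = refl
swap₀₁-involutive (suc (suc i)) = refl

swap₀₁-injective : Injective _≡_ _≡_ (swap₀₁ {n})
swap₀₁-injective {x = i} {j} eq =
  trans (sym (swap₀₁-involutive i)) (trans (cong swap₀₁ eq) (swap₀₁-involutive j))

lookup-swap₀₁ : ∀ {s s′} {σ : State n} (c : Fin (suc (suc n))) →
                lookup (s ∷ s′ ∷ σ) (swap₀₁ c) ≡ lookup (s′ ∷ s ∷ σ) c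
lookup-swap₀₁ zero          = refl
lookup-swap₀₁ (suc zero)    = refl
lookup-swap₀₁ (suc (suc c)) = refl

lookup-lift : ∀ (ρ : Fin n → Fin n′) {σ : State n} {σ′ : State n′} {s} →
              (∀ c → lookup σ′ (ρ c) ≡ lookup σ c) →
              ∀ c → lookup (s ∷ σ′) (lift 1 ρ c) ≡ lookup (s ∷ σ) c
lookup-lift ρ eq zero    = refl
lookup-lift ρ eq (suc c) = eq c

active-rename⁺ : (ρ : Fin n → Fin n′) {c : Fin n} {P : Proc n m k} →
                 Active a c P → Active a (ρ c) (renameNames ρ P)
active-rename⁺ ρ output    = output
active-rename⁺ ρ input     = input
active-rename⁺ ρ (left x)  = left (active-rename⁺ ρ x)
active-rename⁺ ρ (right x) = right (active-rename⁺ ρ x)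
active-rename⁺ ρ (under x) = under (active-rename⁺ (lift 1 ρ) x)

active-rename⁻ : (ρ : Fin n → Fin n′) {c : Fin n′} (P : Proc n m k) →
                 Active a c (renameNames ρ P) → ∃[ d ] c ≡ ρ d × Active a d P
active-rename⁻ ρ (out (name d) vs P) output = d , refl , output
active-rename⁻ ρ (inp (name d) _ P)  input  = d , refl , input
active-rename⁻ ρ (P ∥ Q) (left x) with d , eq , y ← active-rename⁻ ρ P x = d , eq , left y
active-rename⁻ ρ (P ∥ Q) (right x) with d , eq , y ← active-rename⁻ ρ Q x = d , eq , right y
active-rename⁻ ρ (ν s P) (under x) with active-rename⁻ (lift 1 ρ) P x
-- `lift 1 ρ` sends `zero` to `zero`, so the preimage of a shifted name is itself shifted.
... | suc d , eq , y = d , suc-injective eq , under y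

wrong-rename⁺ : (ρ : Fin n → Fin n′) {σ : State n} {σ′ : State n′} {P : Proc n m k} →
                (∀ c → lookup σ′ (ρ c) ≡ lookup σ c) →
                Wrong σ P → Wrong σ′ (renameNames ρ P)
wrong-rename⁺ ρ eq (clash x y a≢b) = clash (active-rename⁺ ρ x) (active-rename⁺ ρ y) a≢b
wrong-rename⁺ ρ eq (dead x c-dead) = dead (active-rename⁺ ρ x) (trans (eq _) c-dead)
wrong-rename⁺ ρ eq (left w)        = left (wrong-rename⁺ ρ eq w)
wrong-rename⁺ ρ eq (right w)       = right (wrong-rename⁺ ρ eq w)
wrong-rename⁺ ρ eq (under w)       = under (wrong-rename⁺ (lift 1 ρ) (lookup-lift ρ eq) w)

-- By injectivity, two prefixes on one renamed name come from one original name; a renaming that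
-- identifies names could create a clash.
wrong-rename⁻ : (ρ : Fin n → Fin n′) → Injective _≡_ _≡_ ρ →
                {σ : State n} {σ′ : State n′} (P : Proc n m k) →
                (∀ c → lookup σ′ (ρ c) ≡ lookup σ c) →
                Wrong σ′ (renameNames ρ P) → Wrong σ P
wrong-rename⁻ ρ inj (P ∥ Q) eq (left w)  = left (wrong-rename⁻ ρ inj P eq w)
wrong-rename⁻ ρ inj (P ∥ Q) eq (right w) = right (wrong-rename⁻ ρ inj Q eq w)
wrong-rename⁻ ρ inj (ν s P) eq (under w) =
  under (wrong-rename⁻ (lift 1 ρ) (lift-injective ρ inj) P (lookup-lift ρ eq) w)
wrong-rename⁻ ρ inj P eq (clash x y a≢b)
  with d , refl , x′ ← active-rename⁻ ρ P x | e , ρd≡ρe , y′ ← active-rename⁻ ρ P y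
  with refl ← inj ρd≡ρe = clash x′ y′ a≢b
wrong-rename⁻ ρ inj P eq (dead x c-dead)
  with d , refl , x′ ← active-rename⁻ ρ P x = dead x′ (trans (sym (eq d)) c-dead)

-- Invariance under structural equivalence

-- Proved together with its converse, because `≅-sym` exchanges the two. The congruences for
-- prefixes change only the continuation and so preserve channel and arity.
active-resp-≅  : ∀ {c : Fin n} {P Q : Proc n m k} → P ≅ Q → Active a c P → Active a c Q
active-resp-≅˘ : ∀ {c : Fin n} {P Q : Proc n m k} → P ≅ Q → Active a c Q → Active a c P

active-resp-≅ ≅-refl          x                 = x
active-resp-≅ (≅-sym e)       x                 = active-resp-≅˘ e x
active-resp-≅ (≅-trans e f)   x                 = active-resp-≅ f (active-resp-≅ e x)
active-resp-≅ ∥-comm          (left x)          = right x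
active-resp-≅ ∥-comm          (right x)         = left x
active-resp-≅ ∥-assoc         (left x)          = left (left x)
active-resp-≅ ∥-assoc         (right (left x))  = left (right x)
active-resp-≅ ∥-assoc         (right (right x)) = right x
active-resp-≅ ∥-nil           (left x)          = x
active-resp-≅ ν-nil           (under ())
active-resp-≅ ν-swap          (under (under x)) = under (under (active-rename⁺ swap₀₁ x))
active-resp-≅ ν-ext           (left x)          = under (left (active-rename⁺ suc x))
active-resp-≅ ν-ext           (right (under x)) = under (right x)
active-resp-≅ (out-cong e)    output            = output
active-resp-≅ (inp-cong e)    input             = input
active-resp-≅ (∥-cong e f)    (left x)          = left (active-resp-≅ e x)
active-resp-≅ (∥-cong e f)    (right x)         = right (active-resp-≅ f x)
active-resp-≅ (ν-cong e)      (under x)         = under (active-resp-≅ e x)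

active-resp-≅˘ ≅-refl         x                 = x
active-resp-≅˘ (≅-sym e)      x                 = active-resp-≅ e x
active-resp-≅˘ (≅-trans e f)  x                 = active-resp-≅˘ e (active-resp-≅˘ f x)
active-resp-≅˘ ∥-comm         (left x)          = right x
active-resp-≅˘ ∥-comm         (right x)         = left x
active-resp-≅˘ ∥-assoc        (left (left x))   = left x
active-resp-≅˘ ∥-assoc        (left (right x))  = right (left x)
active-resp-≅˘ ∥-assoc        (right x)         = right (right x)
active-resp-≅˘ ∥-nil          x                 = left x
active-resp-≅˘ ν-nil          ()
active-resp-≅˘ (ν-swap {P = P}) (under (under x)) with active-rename⁻ swap₀₁ P x
-- Only names beyond the two exchanged ones are sent by `swap₀₁` to a name free outside both
-- binders.
... | suc (suc d) , refl , y = under (under y)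
active-resp-≅˘ (ν-ext {P = P}) (under (left x)) with d , refl , y ← active-rename⁻ suc P x = left y
active-resp-≅˘ ν-ext          (under (right x)) = right (under x)
active-resp-≅˘ (out-cong e)   output            = output
active-resp-≅˘ (inp-cong e)   input             = input
active-resp-≅˘ (∥-cong e f)   (left x)          = left (active-resp-≅˘ e x)
active-resp-≅˘ (∥-cong e f)   (right x)         = right (active-resp-≅˘ f x)
active-resp-≅˘ (ν-cong e)     (under x)         = under (active-resp-≅˘ e x)

-- `renameNames suc P` does not mention the bound name. Hence a clash between it and `Q` is on a
-- shifted name and already shows outside the binder, while an error on the bound name lies entirely
-- within `Q`.
wrong-ext⁻ : ∀ {σ : State n} {s} (P : Proc n m k) {Q : Proc (suc n) m k} →
             Wrong (s ∷ σ) (renameNames suc P ∥ Q) → Wrong σ (P ∥ ν s Q)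
wrong-ext⁻ P (left w)  = left (wrong-rename⁻ suc suc-injective P (λ _ → refl) w)
wrong-ext⁻ P (right w) = right (under w)
wrong-ext⁻ P (dead (left x) c-dead)  = wrong-ext⁻ P (left (dead x c-dead))
wrong-ext⁻ P (dead (right x) c-dead) = right (under (dead x c-dead))
wrong-ext⁻ P (clash (left x) (left y) a≢b)   = wrong-ext⁻ P (left (clash x y a≢b))
wrong-ext⁻ P (clash (right x) (right y) a≢b) = right (under (clash x y a≢b))
wrong-ext⁻ P (clash (left x) (right y) a≢b)
  with d , refl , x′ ← active-rename⁻ suc P x = clash (left x′) (right (under y)) a≢b
wrong-ext⁻ P (clash (right x) (left y) a≢b)
  with d , refl , y′ ← active-rename⁻ suc P y = clash (right (under x)) (left y′) a≢b

nil-not-wrong : ∀ {σ : State n} → ¬ Wrong σ (nil {n} {m} {k})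
nil-not-wrong (clash () _ _)
nil-not-wrong (dead () _)

-- The first two clauses settle errors visible at the top for all laws at once; the others move
-- errors recorded inside a component or a restriction.
wrong-resp-≅  : ∀ {σ : State n} {P Q : Proc n m k} → P ≅ Q → Wrong σ P → Wrong σ Q
wrong-resp-≅˘ : ∀ {σ : State n} {P Q : Proc n m k} → P ≅ Q → Wrong σ Q → Wrong σ P

wrong-resp-≅ e (clash x y a≢b) = clash (active-resp-≅ e x) (active-resp-≅ e y) a≢b
wrong-resp-≅ e (dead x c-dead) = dead (active-resp-≅ e x) c-dead
wrong-resp-≅ ≅-refl          w                     = w
wrong-resp-≅ (≅-sym e)       w                     = wrong-resp-≅˘ e w
wrong-resp-≅ (≅-trans e f)   w                     = wrong-resp-≅ f (wrong-resp-≅ e w)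
wrong-resp-≅ ∥-comm          (left w)              = right w
wrong-resp-≅ ∥-comm          (right w)             = left w
wrong-resp-≅ ∥-assoc         (left w)              = left (left w)
wrong-resp-≅ ∥-assoc         (right (left w))      = left (right w)
wrong-resp-≅ ∥-assoc         (right (right w))     = right w
-- The clash may have one prefix in each component of the inner parallel composition, which the law
-- separates, so it is first restated for the whole process.
wrong-resp-≅ e@∥-assoc       (right (clash x y a≢b)) = wrong-resp-≅ e (clash (right x) (right y) a≢b)
wrong-resp-≅ e@∥-assoc       (right (dead x c-dead)) = wrong-resp-≅ e (dead (right x) c-dead)
wrong-resp-≅ ∥-nil           (left w)              = w
wrong-resp-≅ ∥-nil           (right w)             = ⊥-elim (nil-not-wrong w)
wrong-resp-≅ ν-nil           (under w)             = ⊥-elim (nil-not-wrong w)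
wrong-resp-≅ ν-swap          (under w)             =
  under (under (wrong-rename⁺ swap₀₁ lookup-swap₀₁ (wrong-under⁻ w)))
wrong-resp-≅ ν-ext           (left w)              = under (left (wrong-rename⁺ suc (λ _ → refl) w))
wrong-resp-≅ ν-ext           (right w)             = under (right (wrong-under⁻ w))
wrong-resp-≅ (∥-cong e f)    (left w)              = left (wrong-resp-≅ e w)
wrong-resp-≅ (∥-cong e f)    (right w)             = right (wrong-resp-≅ f w)
wrong-resp-≅ (ν-cong e)      (under w)             = under (wrong-resp-≅ e w)

wrong-resp-≅˘ e (clash x y a≢b) = clash (active-resp-≅˘ e x) (active-resp-≅˘ e y) a≢b
wrong-resp-≅˘ e (dead x c-dead) = dead (active-resp-≅˘ e x) c-dead
wrong-resp-≅˘ ≅-refl         w                     = w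
wrong-resp-≅˘ (≅-sym e)      w                     = wrong-resp-≅ e w
wrong-resp-≅˘ (≅-trans e f)  w                     = wrong-resp-≅˘ e (wrong-resp-≅˘ f w)
wrong-resp-≅˘ ∥-comm         (left w)              = right w
wrong-resp-≅˘ ∥-comm         (right w)             = left w
wrong-resp-≅˘ ∥-assoc        (left (left w))       = left w
wrong-resp-≅˘ ∥-assoc        (left (right w))      = right (left w)
wrong-resp-≅˘ ∥-assoc        (right w)             = right (right w)
wrong-resp-≅˘ e@∥-assoc      (left (clash x y a≢b)) = wrong-resp-≅˘ e (clash (left x) (left y) a≢b)
wrong-resp-≅˘ e@∥-assoc      (left (dead x c-dead)) = wrong-resp-≅˘ e (dead (left x) c-dead)
wrong-resp-≅˘ ∥-nil          w                     = left w
wrong-resp-≅˘ (ν-swap {P = P}) (under w)           =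
  under (under (wrong-rename⁻ swap₀₁ swap₀₁-injective P lookup-swap₀₁ (wrong-under⁻ w)))
wrong-resp-≅˘ (ν-ext {P = P}) (under w)            = wrong-ext⁻ P w
wrong-resp-≅˘ (∥-cong e f)   (left w)              = left (wrong-resp-≅˘ e w)
wrong-resp-≅˘ (∥-cong e f)   (right w)             = right (wrong-resp-≅˘ f w)
wrong-resp-≅˘ (ν-cong e)     (under w)             = under (wrong-resp-≅˘ e w)

Wrongᶜ : Config n m k → Set
Wrongᶜ (σ ▷ P) = Wrong σ P

wrong-ctx : (C : Ctx n′ m k n) {κ : Config n′ m k} → Wrongᶜ κ → Wrongᶜ (C ⟨ κ ⟩)
wrong-ctx hole w = w
wrong-ctx (C ∥ˡ Q) {κ} w with C ⟨ κ ⟩ | wrong-ctx C {κ} w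
... | σ ▷ P | w′ = left w′
wrong-ctx (Q ∥ʳ C) {κ} w with C ⟨ κ ⟩ | wrong-ctx C {κ} w
... | σ ▷ P | w′ = right w′
wrong-ctx (νᶜ C) {κ} w with C ⟨ κ ⟩ | wrong-ctx C {κ} w
... | (s ∷ σ) ▷ P | w′ = under w′

err⇒wrong : {κ : Config n m k} → κ →err → Wrongᶜ κ
err⇒wrong (err-arity a≢b)  = clash (left output) (right input) a≢b
err⇒wrong (err-out c-dead) = dead output c-dead
err⇒wrong (err-inp c-dead) = dead input c-dead
err⇒wrong (err-≅ P≅Q err)  = wrong-resp-≅˘ P≅Q (err⇒wrong err)
err⇒wrong (err-ctx C {κ} err) = wrong-ctx C {κ} (err⇒wrong err)

-- Consistent environments

data Shareable : Attr → Set where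
  aff : Shareable aff
  un  : Shareable un
  •s  : ∀ {i} → Shareable (• suc i)

infix 4 _⌣_

-- Only arities are compared; the payload types may differ. A `proc` assumption restricts nothing,
-- as no prefix is typed by it. The relation is not reflexive: a type with attribute `• 0` is
-- unrelated to itself.
data _⌣_ : Type → Type → Set where
  chan  : ∀ {b α β} {Ts Us : Vec Type b} → Shareable α → Shareable β → [ Ts ]^ α ⌣ [ Us ]^ β
  procˡ : ∀ {T} → proc ⌣ T
  procʳ : ∀ {T} → T ⌣ proc

⌣-sym : ∀ {T U} → T ⌣ U → U ⌣ T
⌣-sym (chan p q) = chan q p
⌣-sym procˡ      = procʳ
⌣-sym procʳ      = procˡ

⌣-split : ∀ {T T₁ T₂} → T ≔ T₁ ∘ T₂ → T₁ ⌣ T₂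
⌣-split split-un   = chan un un
⌣-split split-proc = procˡ
⌣-split split-•    = chan aff •s

⌣-splitˡ : ∀ {T T₁ T₂ U} → T ≔ T₁ ∘ T₂ → T ⌣ U → T₁ ⌣ U
⌣-splitˡ split-un   p           = p
⌣-splitˡ split-proc p           = p
⌣-splitˡ split-•    (chan _ q)  = chan aff q
⌣-splitˡ split-•    procʳ       = procʳ

⌣-splitʳ : ∀ {T T₁ T₂ U} → T ≔ T₁ ∘ T₂ → T ⌣ U → T₂ ⌣ U
⌣-splitʳ split-un   p           = p
⌣-splitʳ split-proc p           = p
⌣-splitʳ split-•    (chan _ q)  = chan •s q
⌣-splitʳ split-•    procʳ       = procʳ

-- No generating rule has `• 0` on its right, so subsumption always leads to a shareable attribute.
shareable-≤ : ∀ {α β} → α ≤ₐ β → Shareable β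
shareable-≤ •≤•    = •s
shareable-≤ •≤un   = un
shareable-≤ un≤aff = aff

⌣-≤ : ∀ {T T′ U} → T ≤ₜ T′ → T ⌣ U → T′ ⌣ U
⌣-≤ (chan-≤ α≤β) (chan _ q) = chan (shareable-≤ α≤β) q
⌣-≤ (chan-≤ _)   procʳ      = procʳ

-- Only `procʳ` is possible here: a `• 0` assumption coexists with no other channel assumption on
-- its identifier, so a change of arity by `tRev` creates no disagreement.
⌣-•₀ : ∀ {Ts : Vec Type a} {Ts′ : Vec Type b} {U} → [ Ts ]^ (• 0) ⌣ U → [ Ts′ ]^ (• 0) ⌣ U
⌣-•₀ procʳ = procʳ

Compatible : Assumption n m k → Assumption n m k → Set
Compatible (u ∶ T)   (v ∶ U)   = u ≡ v → T ⌣ U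
Compatible (u ∶ T)   (X ∶Proc) = ⊤
Compatible (X ∶Proc) _         = ⊤

Consistent : Env n m k → Set
Consistent = AllPairs Compatible

compatible-sym : (A B : Assumption n m k) → Compatible A B → Compatible B A
compatible-sym (u ∶ T)   (v ∶ U)   p = λ { refl → ⌣-sym (p refl) }
compatible-sym (u ∶ T)   (X ∶Proc) p = tt
compatible-sym (X ∶Proc) (u ∶ T)   p = tt
compatible-sym (X ∶Proc) (Y ∶Proc) p = tt

compatible-map : ∀ {u : Ident n m} {T T′} → (∀ {U} → T ⌣ U → T′ ⌣ U) →
                 {A : Assumption n m k} → Compatible (u ∶ T) A → Compatible (u ∶ T′) A
compatible-map f {v ∶ U}   p = f ∘ p
compatible-map f {X ∶Proc} p = tt

-- `AllPairs` compares each pair in one order only, so reordering rests on the symmetry of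
-- `Compatible`. As in the lemmas below, consistency travels from the conclusion of a typing rule to
-- its premises.
consistent-↭ : {Γ Γ′ : Env n m k} → Γ′ ↭ Γ → Consistent Γ → Consistent Γ′
consistent-↭ Γ′↭Γ = SetoidPermutation.AllPairs-resp-↭ (setoid _)
  (λ {A} {B} → compatible-sym A B) (resp₂ Compatible) (↭⇒↭ₛ (↭-sym Γ′↭Γ))

consistent-split : ∀ {Γ : Env n m k} {u T T₁ T₂} → T ≔ T₁ ∘ T₂ →
                   Consistent (u ∶ T ∷ Γ) → Consistent (u ∶ T₁ ∷ u ∶ T₂ ∷ Γ)
consistent-split sp (p ∷ ps) =
  ((λ _ → ⌣-split sp) ∷ All.map (compatible-map (⌣-splitˡ sp)) p)
  ∷ All.map (compatible-map (⌣-splitʳ sp)) p ∷ ps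

consistent-retype : ∀ {Γ : Env n m k} {u T T′} → (∀ {U} → T ⌣ U → T′ ⌣ U) →
                    Consistent (u ∶ T ∷ Γ) → Consistent (u ∶ T′ ∷ Γ)
consistent-retype f (p ∷ ps) = All.map (compatible-map f) p ∷ ps

consistent-splitX : ∀ {Γ : Env n m k} {X : Fin k} →
                    Consistent ((X ∶Proc) ∷ Γ) → Consistent ((X ∶Proc) ∷ (X ∶Proc) ∷ Γ)
consistent-splitX (p ∷ ps) = (tt ∷ p) ∷ p ∷ ps

consistent-++⁻ : (Γ : Env n m k) {Γ′ : Env n m k} → Consistent (Γ ++ Γ′) →
                 Consistent Γ × Consistent Γ′ × All (λ A → All (Compatible A) Γ′) Γ
consistent-++⁻ []      ps       = [] , ps , []
consistent-++⁻ (A ∷ Γ) (p ∷ ps)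
  with qs , rs , cross ← consistent-++⁻ Γ ps =
  Allₚ.++⁻ˡ Γ p ∷ qs , rs , Allₚ.++⁻ʳ Γ p ∷ cross

shift : Env n m k → Env (suc n) m k
shift = renameEnv suc id id

compatible-shift : {A B : Assumption n m k} → Compatible A B →
                   Compatible (renameAssumption suc id id A) (renameAssumption suc id id B)
compatible-shift {A = name c ∶ T} {name d ∶ U} p = λ { refl → p refl }
compatible-shift {A = name c ∶ T} {var y ∶ U}  p = λ ()
compatible-shift {A = var x ∶ T}  {name d ∶ U} p = λ ()
compatible-shift {A = var x ∶ T}  {var y ∶ U}  p = λ { refl → p refl }
compatible-shift {A = u ∶ T}      {X ∶Proc}    p = tt
compatible-shift {A = X ∶Proc}                 p = tt

compatible-fresh : ∀ {T} (A : Assumption n m k) →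
                   Compatible (name zero ∶ T) (renameAssumption suc id id A)
compatible-fresh (name c ∶ U) = λ ()
compatible-fresh (var x ∶ U)  = λ ()
compatible-fresh (X ∶Proc)    = tt

consistent-shift : {Γ : Env n m k} → Consistent Γ → Consistent (shift Γ)
consistent-shift ps = AllPairsₚ.map⁺ (AllPairs.map compatible-shift ps)

-- `T` is arbitrary, even with attribute `• 0`, because no shifted assumption concerns the bound
-- name.
consistent-ν : ∀ {Γ : Env n m k} {T} → Consistent Γ → Consistent (name zero ∶ T ∷ shift Γ)
consistent-ν ps = Allₚ.map⁺ (All.tabulate (λ {A} _ → compatible-fresh A)) ∷ consistent-shift ps

-- Distinct subjects make `Compatible` vacuous. Being a partial function is lost at the first
-- contraction, whereas consistency persists through the derivation.
unique⇒consistent : (Γ : Env n m k) → AllPairs _≢_ (map subject Γ) → Consistent Γ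
unique⇒consistent Γ uniq =
  AllPairs.map (λ {A} {B} → distinct A B) (AllPairsₚ.map⁻ uniq)
  where
  distinct : (A B : Assumption n m k) → subject A ≢ subject B → Compatible A B
  distinct (u ∶ T)   (v ∶ U)   u≢v = λ u≡v → ⊥-elim (u≢v (cong ident u≡v))
  distinct (u ∶ T)   (X ∶Proc) _   = tt
  distinct (X ∶Proc) _         _   = tt

-- Typing of active prefixes

-- The arity recorded for a •₀ assumption is meaningless, because tRev may change it.
data Supports (a : ℕ) : Type → Set where
  exact  : ∀ {α} {Ts : Vec Type a} → Supports a ([ Ts ]^ α)
  any-•₀ : ∀ {b} {Ts : Vec Type b} → Supports a ([ Ts ]^ (• 0))

Supported : ℕ → Fin n → Env n m k → Set
Supported a c Γ = ∃[ T ] Supports a T × (name c ∶ T) ∈ Γ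

supports-splitˡ : ∀ {T T₁ T₂} → T ≔ T₁ ∘ T₂ → Supports a T₁ → Supports a T
supports-splitˡ split-un exact = exact
supports-splitˡ split-•  exact = exact

supports-splitʳ : ∀ {T T₁ T₂} → T ≔ T₁ ∘ T₂ → Supports a T₂ → Supports a T
supports-splitʳ split-un exact = exact
supports-splitʳ split-•  exact = exact

supports-≤ : ∀ {T T′} → T ≤ₜ T′ → Supports a T′ → Supports a T
supports-≤ (chan-≤ _) exact = exact
supports-≤ (chan-≤ ()) any-•₀

-- Compatibility excludes `• 0` on both sides, so both arities are recorded exactly, and `chan`
-- equates them.
supports-⌣ : ∀ {T U} → Supports a T → Supports b U → T ⌣ U → a ≡ b
supports-⌣ exact exact (chan _ _) = refl
supports-⌣ exact any-•₀ (chan _ ())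
supports-⌣ any-•₀ _ (chan () _)

supported-there : ∀ {A} {c : Fin n} {Γ : Env n m k} → Supported a c Γ → Supported a c (A ∷ Γ)
supported-there (T , s , i) = T , s , there i

supported-retype : ∀ {Γ : Env n m k} {u T T′} {c : Fin n} → (Supports a T′ → Supports a T) →
                   Supported a c (u ∶ T′ ∷ Γ) → Supported a c (u ∶ T ∷ Γ)
supported-retype f (T , s , here refl) = _ , f s , here refl
supported-retype f (T , s , there i)   = T , s , there i

supported-shift⁻ : ∀ {Γ : Env n m k} {c : Fin n} → Supported a (suc c) (shift Γ) → Supported a c Γ
supported-shift⁻ (T , s , i) with ∈-map⁻ _ i
... | name c ∶ T , j , refl = T , s , j

-- Read from premise to conclusion, each structural rule keeps the supporting assumption or replaces
-- it by one that still supports `a`; for `tRev` this is `any-•₀`.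
active⇒supported : ∀ {Γ : Env n m k} {P} {c : Fin n} → Γ ⊢ P → Active a c P → Supported a c Γ
active⇒supported (tIn _ _)   input     = _ , exact , here refl
active⇒supported (tOut _ _)  output    = _ , exact , here refl
active⇒supported (tPar p q)  (left x)  with T , s , i ← active⇒supported p x = T , s , ∈-++⁺ˡ i
active⇒supported (tPar p q)  (right x) with T , s , i ← active⇒supported q x = T , s , ∈-++⁺ʳ _ i
active⇒supported (tRst⊤ p)   (under x) with active⇒supported p x
-- The prefix is on a shifted name, so its support is not the assumption on the bound name.
... | T , s , there i = supported-shift⁻ (T , s , i)
active⇒supported (tRst⊥ p)   (under x) = supported-shift⁻ (active⇒supported p x)
active⇒supported (tExch Γ↭Γ′ p) x with T , s , i ← active⇒supported p x = T , s , ∈-resp-↭ Γ↭Γ′ i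
active⇒supported (tCon sp p) x with active⇒supported p x
... | T , s , here refl = _ , supports-splitˡ sp s , here refl
... | T , s , there i   = supported-retype (supports-splitʳ sp) (T , s , i)
active⇒supported (tConX _ p) x with T , s , there i ← active⇒supported p x = T , s , i
active⇒supported (tWeak p)   x = supported-there (active⇒supported p x)
active⇒supported (tWeakX p)  x = supported-there (active⇒supported p x)
active⇒supported (tSub p T≤U) x = supported-retype (supports-≤ T≤U) (active⇒supported p x)
active⇒supported (tRev p)    x = supported-retype (λ _ → any-•₀) (active⇒supported p x)

active-par : ∀ {Γ Γ′ : Env n m k} {P Q} {c : Fin n} →
             All (λ A → All (Compatible A) Γ′) Γ → Γ ⊢ P → Γ′ ⊢ Q →
             Active a c P → Active b c Q → a ≡ b
active-par cross p q x y
  with T , s , i ← active⇒supported p x | U , t , j ← active⇒supported q y =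
  supports-⌣ s t (All.lookup (All.lookup cross i) j refl)

-- Support in `Γ` alone does not suffice, since one `• 0` assumption supports every arity. The
-- derivation is therefore followed up to the `tPar` that separates the two prefixes, where they
-- rest on two compatible assumptions, or to the single prefix that both are.
active-arity-unique : ∀ {Γ : Env n m k} {P} {c : Fin n} → Γ ⊢ P → Consistent Γ →
                      Active a c P → Active b c P → a ≡ b
active-arity-unique (tIn _ _)  con input  input  = refl
active-arity-unique (tOut _ _) con output output = refl
active-arity-unique (tPar {Γ₁ = Γ} p q) con x y with consistent-++⁻ Γ con | x | y
... | con₁ , _ , _   | left x  | left y  = active-arity-unique p con₁ x y
... | _ , con₂ , _   | right x | right y = active-arity-unique q con₂ x y
... | _ , _ , cross  | left x  | right y = active-par cross p q x y
... | _ , _ , cross  | right x | left y  = sym (active-par cross p q y x)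
active-arity-unique (tRst⊤ p) con (under x) (under y) = active-arity-unique p (consistent-ν con) x y
active-arity-unique (tRst⊥ p) con (under x) (under y) = active-arity-unique p (consistent-shift con) x y
active-arity-unique (tExch Γ↭Γ′ p) con = active-arity-unique p (consistent-↭ Γ↭Γ′ con)
active-arity-unique (tCon sp p)    con = active-arity-unique p (consistent-split sp con)
active-arity-unique (tConX _ p)    con = active-arity-unique p (consistent-splitX con)
active-arity-unique (tWeak p)      con = active-arity-unique p (AllPairs.tail con)
active-arity-unique (tWeakX p)     con = active-arity-unique p (AllPairs.tail con)
active-arity-unique (tSub p T≤U)   con = active-arity-unique p (consistent-retype (⌣-≤ T≤U) con)
active-arity-unique (tRev p)       con = active-arity-unique p (consistent-retype ⌣-•₀ con)

-- Safety

-- Liveness depends on the subject alone, so splitting, subsumption and `tRev` pass its evidence on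
-- unchanged.
LiveSubject : State n → Subject n m k → Set
LiveSubject σ (ident (name c)) = lookup σ c ≡ allocated
LiveSubject σ (ident (var _))  = ⊤
LiveSubject σ (procVar _)      = ⊤

Live : State n → Env n m k → Set
Live σ = All (LiveSubject σ ∘ subject)

live-shift : ∀ {σ : State n} {s} {Γ : Env n m k} → Live σ Γ → Live (s ∷ σ) (shift Γ)
live-shift {σ = σ} {s} live = Allₚ.map⁺ (All.map (λ {A} → step A) live)
  where
  step : ∀ A → LiveSubject σ (subject A) →
         LiveSubject (s ∷ σ) (subject (renameAssumption suc id id A))
  step (name c ∶ T) l = l
  step (var x ∶ T)  l = tt
  step (X ∶Proc)    l = tt

typed-not-wrong : ∀ {Γ : Env n m k} {σ P} → Γ ⊢ P → Consistent Γ → Live σ Γ → ¬ Wrong σ P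
typed-not-wrong p con live (clash x y a≢b) = a≢b (active-arity-unique p con x y)
typed-not-wrong p con live (dead x c-dead)
  with T , _ , i ← active⇒supported p x
  with () ← trans (sym c-dead) (All.lookup live i)
typed-not-wrong (tPar {Γ₁ = Γ} p q) con live (left w) =
  typed-not-wrong p (proj₁ (consistent-++⁻ Γ con)) (Allₚ.++⁻ˡ Γ live) w
typed-not-wrong (tPar {Γ₁ = Γ} p q) con live (right w) =
  typed-not-wrong q (proj₁ (proj₂ (consistent-++⁻ Γ con))) (Allₚ.++⁻ʳ Γ live) w
typed-not-wrong (tRst⊤ p) con live (under w) =
  typed-not-wrong p (consistent-ν con) (refl ∷ live-shift live) w
-- The bound channel is deallocated, but the shifted environment has no assumption on it, so
-- liveness survives.
typed-not-wrong (tRst⊥ p) con live (under w) =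
  typed-not-wrong p (consistent-shift con) (live-shift live) w
typed-not-wrong (tExch Γ↭Γ′ p) con live w =
  typed-not-wrong p (consistent-↭ Γ↭Γ′ con) (All-resp-↭ (↭-sym Γ↭Γ′) live) w
typed-not-wrong (tCon sp p) con (l ∷ live) w =
  typed-not-wrong p (consistent-split sp con) (l ∷ l ∷ live) w
typed-not-wrong (tConX _ p) con (l ∷ live) w =
  typed-not-wrong p (consistent-splitX con) (l ∷ l ∷ live) w
typed-not-wrong (tWeak p)  con (l ∷ live) w = typed-not-wrong p (AllPairs.tail con) live w
typed-not-wrong (tWeakX p) con (l ∷ live) w = typed-not-wrong p (AllPairs.tail con) live w
typed-not-wrong (tSub p T≤U) con (l ∷ live) w =
  typed-not-wrong p (consistent-retype (⌣-≤ T≤U) con) (l ∷ live) w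
typed-not-wrong (tRev p) con (l ∷ live) w =
  typed-not-wrong p (consistent-retype ⌣-•₀ con) (l ∷ live) w

live-tabulate : ∀ {Γ : Env n m k} {σ} →
                (∀ c → name c occursIn Γ → lookup σ c ≡ allocated) → Live σ Γ
live-tabulate {Γ = Γ} {σ} live = All.tabulate (λ {A} → step A)
  where
  step : ∀ A → A ∈ Γ → LiveSubject σ (subject A)
  step (name c ∶ T) i = live c (T , i)
  step (var x ∶ T)  i = tt
  step (X ∶Proc)    i = tt

mainTheorem2 : ∀ {n m k : ℕ} (Γ : Env n m k) (σ : State n) (P : Proc n m k) →
    Γ ⊢ᶜ σ ▷ P → ¬ (σ ▷ P →err)
mainTheorem2 Γ σ P typed err =
  typed-not-wrong well-typed (unique⇒consistent Γ functional) (live-tabulate live) (err⇒wrong err)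
  where open _⊢ᶜ_ typed
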